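{- Let $H$ be a graph that is a disjoint union of cycles (i.e. every connected component of $H$ is a cycle). Then $$c(H) \leq \frac{v(H)+\mathrm{comp}(H)}{2}-1.$$
   Context: All graphs are finite and simple. For a graph $G$, $v(G)$ and $e(G)$ denote its numbers of vertices and edges. A graph $H$ is a minor of $G$ if a graph isomorphic to $H$ can be obtained from a subgraph of $G$ by contracting edges. For a graph $H$ with $v(H)\ge 2$, $c(H)$ is the supremum of $e(G)/v(G)$ over all non-null graphs $G$ (i.e. $v(G)\ge 1$) not containing $H$ as a minor. $\mathrm{comp}(H)$ denotes the number of connected components of $H$. -}

module Defs where

open import Data.Nat using (ℕ; zero; suc; _+_; _<?_)
open import Data.Bool using (Bool; true; false; _∧_)
open import Data.Fin using (Fin; toℕ)
open import Data.Maybe using (Maybe; just)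
open import Data.Product using (Σ; _×_; ∃; ∃-syntax)
open import Data.Sum using (_⊎_)
open import Relation.Binary.PropositionalEquality using (_≡_)
open import Relation.Nullary.Decidable using (⌊_⌋)

record Graph : Set where
  field
    n      : ℕ
    adj    : Fin n → Fin n → Bool
    sym    : ∀ i j → adj i j ≡ adj j i
    irrefl : ∀ i → adj i i ≡ false
open Graph public

v : Graph → ℕ
v G = n G

sumFin : (m : ℕ) → (Fin m → ℕ) → ℕ
sumFin zero    f = 0
sumFin (suc m) f = f Fin.zero + sumFin m (λ i → f (Fin.suc i))

b2n : Bool → ℕ
b2n true  = 1
b2n false = 0

e : Graph → ℕ
e G = sumFin (n G) (λ i → sumFin (n G) (λ j →
        b2n (⌊ toℕ i <? toℕ j ⌋ ∧ adj G i j)))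

data Walk (G : Graph) (P : Fin (n G) → Set) : Fin (n G) → Fin (n G) → Set where
  here : ∀ {u} → P u → Walk G P u u
  step : ∀ {u w t} → P u → adj G u w ≡ true → Walk G P w t → Walk G P u t

-- A minor model of H in G: φ assigns each vertex of G to at most one branch
-- set (so branch sets are pairwise disjoint); branch sets are non-empty and
-- connected, and every edge of H is realised by an edge of G between the
-- corresponding branch sets.  H is a minor of G iff such a model exists.
record MinorModel (H G : Graph) : Set where
  field
    φ         : Fin (n G) → Maybe (Fin (n H))
    nonempty  : ∀ x → ∃[ u ] (φ u ≡ just x)
    connected : ∀ x u w → φ u ≡ just x → φ w ≡ just x →
                Walk G (λ z → φ z ≡ just x) u w
    edges     : ∀ x y → adj H x y ≡ true →
                ∃[ u ] ∃[ w ] (φ u ≡ just x × φ w ≡ just y × adj G u w ≡ true)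

IsMinor : Graph → Graph → Set
IsMinor H G = MinorModel H G

-- Adjacency in the disjoint union of cycles C_{ℓ 0} ⊔ … ⊔ C_{ℓ (k-1)},
-- with vertex set Σ i, Fin (ℓ i); vertex a of cycle i is adjacent to a+1 mod ℓ i.
CycNext : ∀ {k} (ℓ : Fin k → ℕ) → Σ (Fin k) (λ i → Fin (ℓ i)) → Σ (Fin k) (λ i → Fin (ℓ i)) → Set
CycNext ℓ (i Data.Product., a) (j Data.Product., b) =
  i ≡ j × ((suc (toℕ a) ≡ toℕ b) ⊎ (suc (toℕ a) ≡ ℓ i × toℕ b ≡ 0))

CycAdj : ∀ {k} (ℓ : Fin k → ℕ) → Σ (Fin k) (λ i → Fin (ℓ i)) → Σ (Fin k) (λ i → Fin (ℓ i)) → Set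
CycAdj ℓ p q = CycNext ℓ p q ⊎ CycNext ℓ q p

{-# OPTIONS --safe #-}

-- Two facts are combined, both stated with n − 1 in place of the number n of
-- vertices so that they fit together; in both, e is the number of edges.
--
-- (Csóka, Lo, Norin, Wu, Yepremyan) If 2e > (s + t + 2)(n − 1) and t ≥ 2, the
-- vertices split into A and B with 2e(A) > s(|A| − 1) and 2e(B) > t(|B| − 1).
-- Move vertices one at a time from B to A, starting from a single vertex. For
-- a uniformly random choice the expected new value of
-- e(A)/(|A| − 1) + e(B)/(|B| − 1) is a convex combination of the old one and
-- e/(n − 1), so it can be kept at least e/(n − 1) throughout. One move raises
-- 2e(A)/(|A| − 1) to at most s + 2 if it was at most s, so when that quantity
-- first exceeds s, more than t is left for B.
--
-- (Erdős–Gallai) If 2e > m(n − 1), there is a cycle of length greater than m.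
-- Otherwise take a longest path, let W be its first m vertices, and let U be
-- the set of first vertices of the paths obtained from it by permuting W.
-- Neighbours of u ∈ U lie in W, and rotations give deg u ≤ |U|; hence
-- deg_U u + 2 deg_{V∖U} u ≤ |U| + |W∖U| ≤ m, so at most m|U|/2 edges touch U,
-- and U can be deleted.
--
-- The first fact with s = ℓ − 1 splits off one cycle of length at least ℓ at a
-- time; the second one finds it.
module Submission where

open import Defs
open import Data.Nat hiding (_≟_)
open import Data.Nat.Properties hiding (_≟_)
open import Data.Nat.Tactic.RingSolver using (solve-∀)
open import Data.Bool using (true; false; _∧_; if_then_else_)
open import Data.Empty using (⊥; ⊥-elim)
open import Data.Fin using (Fin; zero; suc; toℕ; fromℕ; fromℕ<; splitAt; _↑ˡ_; _↑ʳ_)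
open import Data.Fin.Properties
  using (_≟_; toℕ-injective; toℕ-fromℕ; injective⇒≤; splitAt⁻¹-↑ˡ; splitAt⁻¹-↑ʳ)
open import Data.List using (List; []; _∷_; _++_; length; map; take; drop; tabulate; allFin)
open import Data.List.Properties
  using (length-++; ++-assoc; ++-identityʳ; length-take; take++drop≡id; length-tabulate; map-++; map-∘)
open import Data.List.Membership.Propositional using (_∈_)
open import Data.List.Membership.Propositional.Properties
  using (∈-∃++; ∈-map⁺; ∈-map⁻; ∈-++⁺ˡ; ∈-++⁺ʳ; ∈-++⁻)
open import Data.List.Relation.Unary.All as All using (All; []; _∷_)
open import Data.List.Relation.Unary.AllPairs using (_∷_)
open import Data.List.Relation.Unary.Any using (here; there)
open import Data.List.Relation.Unary.Linked using (Linked; []; [-]; _∷_; head; tail)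
open import Data.List.Relation.Unary.Unique.Propositional using (Unique)
open import Data.List.Relation.Unary.Unique.Propositional.Properties using (allFin⁺)
open import Data.List.Relation.Binary.Permutation.Propositional
  using (_↭_; refl; prep; swap; trans; ↭-sym; ↭-trans; ↭-reflexive; ↭⇒↭ₛ)
open import Data.List.Relation.Binary.Permutation.Propositional.Properties
  using (↭-length; shift; shifts; ++⁺; ++⁺ˡ; ++⁺ʳ; ++-comm)
import Data.List.Relation.Binary.Permutation.Setoid.Properties as Permutationₛ
open import Data.Maybe as Maybe using (Maybe; just; nothing)
open import Data.Maybe.Properties using (just-injective)
open import Data.Product using (Σ; _×_; _,_; ∃-syntax; ∃₂; proj₁; proj₂; map₂)
open import Data.Sum using (_⊎_; inj₁; inj₂)
open import Data.Unit using (⊤; tt)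
open import Function using (_∘_; id)
open import Function.Bundles using (_↔_; Inverse)
open import Relation.Binary.PropositionalEquality as ≡
  using (_≡_; cong; cong₂; subst; module ≡-Reasoning)
open import Relation.Nullary using (¬_; Dec; does; yes; no)
open import Relation.Nullary.Decidable using (⌊_⌋; decidable-stable; ¬¬-excluded-middle)

-- Sums over lists and averaging.

∑ : {A : Set} → (A → ℕ) → List A → ℕ
∑ f []       = 0
∑ f (x ∷ xs) = f x + ∑ f xs

module _ {A : Set} where

  ∑-cong : ∀ {f g : A → ℕ} → (∀ x → f x ≡ g x) → ∀ xs → ∑ f xs ≡ ∑ g xs
  ∑-cong f≗g []       = ≡.refl
  ∑-cong f≗g (x ∷ xs) = cong₂ _+_ (f≗g x) (∑-cong f≗g xs)

  ∑-mono : ∀ {f g : A → ℕ} xs → (∀ {x} → x ∈ xs → f x ≤ g x) → ∑ f xs ≤ ∑ g xs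
  ∑-mono []       f≤g = z≤n
  ∑-mono (x ∷ xs) f≤g = +-mono-≤ (f≤g (here ≡.refl)) (∑-mono xs (f≤g ∘ there))

  ∑-+ : ∀ (f g : A → ℕ) xs → ∑ (λ x → f x + g x) xs ≡ ∑ f xs + ∑ g xs
  ∑-+ f g []       = ≡.refl
  ∑-+ f g (x ∷ xs) = ≡.trans (cong (f x + g x +_) (∑-+ f g xs)) (interchange (f x) (g x) _ _)
    where
    interchange : ∀ a b c d → a + b + (c + d) ≡ a + c + (b + d)
    interchange = solve-∀

  ∑-* : ∀ c (f : A → ℕ) xs → ∑ (λ x → c * f x) xs ≡ c * ∑ f xs
  ∑-* c f []       = ≡.sym (*-zeroʳ c)
  ∑-* c f (x ∷ xs) = ≡.trans (cong (c * f x +_) (∑-* c f xs)) (≡.sym (*-distribˡ-+ c (f x) _))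

  ∑-const : ∀ c (xs : List A) → ∑ (λ _ → c) xs ≡ length xs * c
  ∑-const c []       = ≡.refl
  ∑-const c (x ∷ xs) = cong (c +_) (∑-const c xs)

  ∑-++ : ∀ (f : A → ℕ) xs ys → ∑ f (xs ++ ys) ≡ ∑ f xs + ∑ f ys
  ∑-++ f []       ys = ≡.refl
  ∑-++ f (x ∷ xs) ys = ≡.trans (cong (f x +_) (∑-++ f xs ys)) (≡.sym (+-assoc (f x) _ _))

  ∑-↭ : ∀ (f : A → ℕ) {xs ys} → xs ↭ ys → ∑ f xs ≡ ∑ f ys
  ∑-↭ f refl         = ≡.refl
  ∑-↭ f (prep x p)   = cong (f x +_) (∑-↭ f p)
  ∑-↭ f (swap x y p) = ≡.trans (exchange (f x) (f y) _) (cong (λ z → f y + (f x + z)) (∑-↭ f p))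
    where
    exchange : ∀ a b c → a + (b + c) ≡ b + (a + c)
    exchange = solve-∀
  ∑-↭ f (trans p q)  = ≡.trans (∑-↭ f p) (∑-↭ f q)

  -- Averaging: a head that violates the pointwise bound can be cancelled, and the bound between the
  -- sums passes to the tail. This replaces the random choice of the vertex to move.
  ∑-pick : ∀ (f g : A → ℕ) x xs → ∑ g (x ∷ xs) ≤ ∑ f (x ∷ xs) →
           ∃[ y ] (y ∈ x ∷ xs × g y ≤ f y)
  ∑-pick f g x xs ∑g≤∑f with g x ≤? f x
  ... | yes gx≤fx = x , here ≡.refl , gx≤fx
  ... | no  gx≰fx with xs
  ...   | [] = ⊥-elim (gx≰fx (≤-trans (m≤m+n (g x) 0) (≤-trans ∑g≤∑f (≤-reflexive (+-identityʳ (f x))))))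
  ...   | z ∷ zs with ∑-pick f g z zs (+-cancelˡ-≤ (f x) _ _
                        (≤-trans (+-monoˡ-≤ _ (<⇒≤ (≰⇒> gx≰fx))) ∑g≤∑f))
  ...     | y , y∈ , gy≤fy = y , there y∈ , gy≤fy

∑-swap : ∀ {A B : Set} (f : A → B → ℕ) xs ys →
         ∑ (λ x → ∑ (f x) ys) xs ≡ ∑ (λ y → ∑ (λ x → f x y) xs) ys
∑-swap f []       ys = ≡.sym (≡.trans (∑-const 0 ys) (*-zeroʳ (length ys)))
∑-swap f (x ∷ xs) ys = ≡.trans (cong (∑ (f x) ys +_) (∑-swap f xs ys)) (≡.sym (∑-+ (f x) _ ys))

∈⇒↭ : ∀ {A : Set} {x : A} {xs} → x ∈ xs → ∃[ ys ] (xs ↭ x ∷ ys)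
∈⇒↭ x∈xs with ∈-∃++ x∈xs
... | as , bs , ≡.refl = as ++ bs , shift _ as bs

-- Splitting a dense vertex set into two dense parts.

module Density {V : Set} (d : V → V → ℕ) (d-sym : ∀ u w → d u w ≡ d w u)
               (d-irrefl : ∀ u → d u u ≡ 0) (d≤1 : ∀ u w → d u w ≤ 1) where

  deg : V → List V → ℕ
  deg u = ∑ (d u)

  -- For a duplicate-free S, E S S is twice the number of edges inside S.
  E : List V → List V → ℕ
  E L M = ∑ (λ u → deg u M) L

  deg≤length : ∀ u L → deg u L ≤ length L
  deg≤length u L = ≤-trans (∑-mono L (λ {w} _ → d≤1 u w))
                           (≤-reflexive (≡.trans (∑-const 1 L) (*-identityʳ _)))

  E-sym : ∀ L M → E L M ≡ E M L
  E-sym L M = ≡.trans (∑-swap d L M) (∑-cong (λ w → ∑-cong (λ u → d-sym u w) L) M)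

  E-++ˡ : ∀ L L′ M → E (L ++ L′) M ≡ E L M + E L′ M
  E-++ˡ L L′ M = ∑-++ _ L L′

  E-++ʳ : ∀ L M M′ → E L (M ++ M′) ≡ E L M + E L M′
  E-++ʳ L M M′ = ≡.trans (∑-cong (λ u → ∑-++ (d u) M M′) L) (∑-+ _ _ L)

  E-++ : ∀ A B → E (A ++ B) (A ++ B) ≡ E A A + E B B + 2 * E A B
  E-++ A B = begin
    E (A ++ B) (A ++ B)                     ≡⟨ E-++ˡ A B (A ++ B) ⟩
    E A (A ++ B) + E B (A ++ B)             ≡⟨ cong₂ _+_ (E-++ʳ A A B) (E-++ʳ B A B) ⟩
    E A A + E A B + (E B A + E B B)         ≡⟨ cong (λ z → E A A + E A B + (z + E B B)) (E-sym B A) ⟩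
    E A A + E A B + (E A B + E B B)         ≡⟨ arith (E A A) (E A B) (E B B) ⟩
    E A A + E B B + 2 * E A B               ∎
    where
    open ≡-Reasoning
    arith : ∀ a c b → a + c + (c + b) ≡ a + b + 2 * c
    arith = solve-∀

  E-↭ : ∀ {L M} → L ↭ M → E L L ≡ E M M
  E-↭ {L} {M} p = ≡.trans (∑-cong (λ u → ∑-↭ (d u) p) L) (∑-↭ _ p)

  E-[_] : ∀ x → E (x ∷ []) (x ∷ []) ≡ 0
  E-[ x ] = cong (λ z → z + 0 + 0) (d-irrefl x)

  E-∷ : ∀ y A → E (y ∷ A) (y ∷ A) ≡ E A A + 2 * deg y A
  E-∷ y A = ≡.trans (E-++ (y ∷ []) A)
    (cong₂ (λ a b → a + E A A + 2 * b) E-[ y ] (+-identityʳ (deg y A)))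

  -- Moving y from B to A, the sum over y ∈ B of the new value of a q + b p
  -- is μ (a q + b p + e); this is that computation with the subtracted terms
  -- 2 deg y B moved to the other side.
  average-identity : ∀ N a b c p μ →
    N * (((2 + μ) * a + 2 * c) * μ + (2 + μ) * b * suc p) ≡
    N * (2 * b * suc p) + (μ * (N * (a * suc μ + b * p)) + N * μ * (a + b + 2 * c))
  average-identity = solve-∀

  -- With |B| = μ + 2, this takes out μ times the left side of the old `Balanced`, to which the
  -- hypothesis applies.
  average-rhs : ∀ e p μ → (2 + μ) * (e * (suc p * μ)) ≡
    μ * (e * (p * suc μ)) + suc (p + suc μ) * μ * e
  average-rhs = solve-∀

  -- E A A / p + E B B / q ≥ E S S / (|S| − 1) for S = A ++ B, |A| = p + 1 and
  -- |B| = q + 1, cleared of denominators.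
  Balanced : ℕ → ℕ → List V → List V → Set
  Balanced p q A B = E (A ++ B) (A ++ B) * (p * q) ≤ suc (p + q) * (E A A * q + E B B * p)

  deg-irrefl : ∀ y {B B′} → B ↭ y ∷ B′ → deg y B ≡ deg y B′
  deg-irrefl y {B′ = B′} p = ≡.trans (∑-↭ (d y) p) (cong (_+ deg y B′) (d-irrefl y))

  -- The terms at y are the two sides of the `Balanced` wanted after moving y, both increased by
  -- `suc (p + suc μ) * (2 * deg y B * suc p)`, which `advance` cancels.
  advance-average : ∀ p μ A B → length B ≡ suc (suc μ) → Balanced p (suc μ) A B →
    ∑ (λ y → E (A ++ B) (A ++ B) * (suc p * μ) + suc (p + suc μ) * (2 * deg y B * suc p)) B ≤
    ∑ (λ y → suc (p + suc μ) * ((E A A + 2 * deg y A) * μ + E B B * suc p)) B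
  advance-average p μ A B |B| bal = begin
    ∑ (λ y → ab * (suc p * μ) + N * (2 * deg y B * suc p)) B
      ≡⟨ ∑-+ (λ _ → ab * (suc p * μ)) (λ y → N * (2 * deg y B * suc p)) B ⟩
    ∑ (λ _ → ab * (suc p * μ)) B + ∑ (λ y → N * (2 * deg y B * suc p)) B
      ≡⟨ cong₂ _+_ (≡.trans (∑-const _ B) (cong (_* (ab * (suc p * μ))) |B|)) ∑deg ⟩
    (2 + μ) * (ab * (suc p * μ)) + N * (2 * b * suc p)
      ≡⟨ cong (_+ N * (2 * b * suc p)) (average-rhs ab p μ) ⟩
    μ * (ab * (p * suc μ)) + N * μ * ab + N * (2 * b * suc p)
      ≤⟨ +-monoˡ-≤ _ (+-mono-≤ (*-monoʳ-≤ μ bal) (≤-reflexive (cong (N * μ *_) ab≡))) ⟩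
    μ * (N * (a * suc μ + b * p)) + N * μ * (a + b + 2 * c) + N * (2 * b * suc p)
      ≡⟨ +-comm _ (N * (2 * b * suc p)) ⟩
    N * (2 * b * suc p) + (μ * (N * (a * suc μ + b * p)) + N * μ * (a + b + 2 * c))
      ≡⟨ average-identity N a b c p μ ⟨
    N * (((2 + μ) * a + 2 * c) * μ + (2 + μ) * b * suc p)
      ≡⟨ cong (λ m → N * ((m * a + 2 * c) * μ + m * b * suc p)) |B| ⟨
    N * ((length B * a + 2 * c) * μ + length B * b * suc p)
      ≡⟨ cong (N *_) (cong₂ _+_ ∑a ∑b) ⟨
    N * (∑ (λ y → (a + 2 * deg y A) * μ) B + ∑ (λ _ → b * suc p) B)
      ≡⟨ cong (N *_) (∑-+ (λ y → (a + 2 * deg y A) * μ) (λ _ → b * suc p) B) ⟨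
    N * ∑ (λ y → (a + 2 * deg y A) * μ + b * suc p) B
      ≡⟨ ∑-* N (λ y → (a + 2 * deg y A) * μ + b * suc p) B ⟨
    ∑ (λ y → N * ((a + 2 * deg y A) * μ + b * suc p)) B ∎
    where
    open ≤-Reasoning
    N = suc (p + suc μ)
    a = E A A
    b = E B B
    c = E B A
    ab = E (A ++ B) (A ++ B)
    pull : ∀ n x k → n * (2 * x * k) ≡ n * 2 * k * x
    pull = solve-∀
    ∑deg : ∑ (λ y → N * (2 * deg y B * suc p)) B ≡ N * (2 * b * suc p)
    ∑deg = ≡.trans (∑-cong (λ y → pull N (deg y B) (suc p)) B)
           (≡.trans (∑-* (N * 2 * suc p) (λ y → deg y B) B) (≡.sym (pull N b (suc p))))
    ab≡ : ab ≡ a + b + 2 * c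
    ab≡ = ≡.trans (E-++ A B) (cong (λ z → a + b + 2 * z) (E-sym A B))
    ∑a : ∑ (λ y → (a + 2 * deg y A) * μ) B ≡ (length B * a + 2 * c) * μ
    ∑a = begin-equality
      ∑ (λ y → (a + 2 * deg y A) * μ) B        ≡⟨ ∑-cong (λ y → *-comm (a + 2 * deg y A) μ) B ⟩
      ∑ (λ y → μ * (a + 2 * deg y A)) B        ≡⟨ ∑-* μ (λ y → a + 2 * deg y A) B ⟩
      μ * ∑ (λ y → a + 2 * deg y A) B          ≡⟨ cong (μ *_) (∑-+ (λ _ → a) (λ y → 2 * deg y A) B) ⟩
      μ * (∑ (λ _ → a) B + ∑ (λ y → 2 * deg y A) B)
        ≡⟨ cong (μ *_) (cong₂ _+_ (∑-const a B) (∑-* 2 (λ y → deg y A) B)) ⟩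
      μ * (length B * a + 2 * c)               ≡⟨ *-comm μ _ ⟩
      (length B * a + 2 * c) * μ               ∎
    ∑b : ∑ (λ _ → b * suc p) B ≡ length B * b * suc p
    ∑b = ≡.trans (∑-const _ B) (≡.sym (*-assoc (length B) b (suc p)))

  advance : ∀ p μ A B → length B ≡ suc (suc μ) → Balanced p (suc μ) A B →
            ∃[ y ] ∃[ B′ ] (B ↭ y ∷ B′ × Balanced (suc p) μ (y ∷ A) B′)
  advance p μ A B@(z ∷ zs) |B| bal with
    ∑-pick (λ y → suc (p + suc μ) * ((E A A + 2 * deg y A) * μ + E B B * suc p))
           (λ y → E (A ++ B) (A ++ B) * (suc p * μ) + suc (p + suc μ) * (2 * deg y B * suc p))
           z zs (advance-average p μ A B |B| bal)
  ... | y , y∈B , le with ∈⇒↭ y∈B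
  ...   | B′ , B↭ = y , B′ , B↭ , +-cancelʳ-≤ (N * (2 * deg y B * suc p)) _ _ (begin
      E (y ∷ A ++ B′) (y ∷ A ++ B′) * (suc p * μ) + N * (2 * deg y B * suc p)
        ≡⟨ cong (λ z → z * (suc p * μ) + N * (2 * deg y B * suc p))
             (E-↭ (↭-trans (++⁺ˡ A B↭) (shift y A B′))) ⟨
      E (A ++ B) (A ++ B) * (suc p * μ) + N * (2 * deg y B * suc p)
        ≤⟨ le ⟩
      N * ((E A A + 2 * deg y A) * μ + E B B * suc p)
        ≡⟨ cong₂ (λ x z → N * (x * μ + z * suc p)) (≡.sym (E-∷ y A)) b≡ ⟩
      N * (E (y ∷ A) (y ∷ A) * μ + (E B′ B′ + 2 * deg y B) * suc p)
        ≡⟨ arith N _ (E B′ B′) (deg y B) (suc p) ⟩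
      N * (E (y ∷ A) (y ∷ A) * μ + E B′ B′ * suc p) + N * (2 * deg y B * suc p)
        ≡⟨ cong (λ n → n * (E (y ∷ A) (y ∷ A) * μ + E B′ B′ * suc p) + N * (2 * deg y B * suc p))
             (cong suc (+-suc p μ)) ⟩
      suc (suc p + μ) * (E (y ∷ A) (y ∷ A) * μ + E B′ B′ * suc p) + N * (2 * deg y B * suc p) ∎)
    where
    open ≤-Reasoning
    N = suc (p + suc μ)
    b≡ : E B B ≡ E B′ B′ + 2 * deg y B
    b≡ = ≡.trans (E-↭ B↭) (≡.trans (E-∷ y B′) (cong (λ z → E B′ B′ + 2 * z) (≡.sym (deg-irrefl y B↭))))
    arith : ∀ n x b c k → n * (x + (b + 2 * c) * k) ≡ n * (x + b * k) + n * (2 * c * k)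
    arith = solve-∀

  Splits : ℕ → ℕ → List V → Set
  Splits s t S = ∃₂ λ A B → S ↭ A ++ B × s * (length A ∸ 1) < E A A × t * (length B ∸ 1) < E B B

  -- For |B| = 1 the condition `Balanced` is vacuous, since its left side has the factor q = 0.
  -- Instead, z adds at most 2|A| to `E A A`, and by `2 ≤ t` the total is too small.
  one-vertex-left : ∀ s t p A z → 2 ≤ t → length A ≡ suc p → E A A ≤ (s + 2) * p →
    (s + t + 2) * suc p < E (A ++ z ∷ []) (A ++ z ∷ []) → ⊥
  one-vertex-left s t p A z 2≤t |A| a≤ e> = <-irrefl ≡.refl (begin-strict
    (s + t + 2) * suc p                        <⟨ e> ⟩
    E (A ++ z ∷ []) (A ++ z ∷ [])              ≡⟨ E-++ A (z ∷ []) ⟩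
    E A A + E (z ∷ []) (z ∷ []) + 2 * E A (z ∷ [])
      ≡⟨ cong₂ (λ x y → E A A + x + 2 * y) E-[ z ] (≡.trans (E-sym A (z ∷ [])) (+-identityʳ (deg z A))) ⟩
    E A A + 0 + 2 * deg z A
      ≤⟨ +-mono-≤ (+-monoˡ-≤ 0 a≤) (*-monoʳ-≤ 2 (≤-trans (deg≤length z A) (≤-reflexive |A|))) ⟩
    (s + 2) * p + 0 + 2 * suc p                ≤⟨ m≤m+n _ (s + 2) ⟩
    (s + 2) * p + 0 + 2 * suc p + (s + 2)      ≡⟨ arith s p ⟩
    (s + 2 + 2) * suc p                        ≤⟨ *-monoˡ-≤ (suc p) (+-monoˡ-≤ 2 (+-monoʳ-≤ s 2≤t)) ⟩
    (s + t + 2) * suc p                        ∎)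
    where
    open ≤-Reasoning
    arith : ∀ s p → (s + 2) * p + 0 + 2 * suc p + (s + 2) ≡ (s + 2 + 2) * suc p
    arith = solve-∀

  -- If `E B B` were at most `t * μ`, then `Balanced` would bound the density of the whole set by (s
  -- + 2) + t. Clearing denominators needs p and μ positive, hence the separate case μ = 0.
  complement-dense : ∀ s t p μ A B → 2 ≤ t → length A ≡ suc p → length B ≡ suc μ →
    1 ≤ p → E A A ≤ (s + 2) * p → Balanced p μ A B →
    (s + t + 2) * suc (p + μ) < E (A ++ B) (A ++ B) → t * μ < E B B
  complement-dense s t p zero A (z ∷ []) 2≤t |A| |B| _ a≤ bal e> =
    ⊥-elim (one-vertex-left s t p A z 2≤t |A| a≤
      (subst (λ k → (s + t + 2) * suc k < E (A ++ z ∷ []) (A ++ z ∷ [])) (+-identityʳ p) e>))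
  complement-dense s t (suc p) (suc μ) A B 2≤t |A| |B| _ a≤ bal e> =
    ≰⇒> λ b≤ → <-irrefl ≡.refl (begin-strict
      (s + t + 2) * suc (P + M) * (P * M)            <⟨ *-monoˡ-< (P * M) e> ⟩
      E (A ++ B) (A ++ B) * (P * M)                  ≤⟨ bal ⟩
      suc (P + M) * (E A A * M + E B B * P)
        ≤⟨ *-monoʳ-≤ (suc (P + M)) (+-mono-≤ (*-monoˡ-≤ M a≤) (*-monoˡ-≤ P b≤)) ⟩
      suc (P + M) * ((s + 2) * P * M + t * M * P)    ≡⟨ arith s t P M ⟩
      (s + t + 2) * suc (P + M) * (P * M)            ∎)
    where
    open ≤-Reasoning
    P = suc p
    M = suc μ
    arith : ∀ s t P M → suc (P + M) * ((s + 2) * P * M + t * M * P) ≡ (s + t + 2) * suc (P + M) * (P * M)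
    arith = solve-∀

  -- Induction on |B|: the first move that takes A above density s ends the process, and B cannot
  -- shrink to one vertex while A is still sparse.
  grow : ∀ s t → 2 ≤ t → ∀ q p A B → length A ≡ suc p → length B ≡ suc q →
         Balanced p q A B → E A A ≤ s * p →
         (s + t + 2) * suc (p + q) < E (A ++ B) (A ++ B) → Splits s t (A ++ B)
  grow s t 2≤t zero p A (z ∷ []) |A| |B| bal a≤ e> =
    ⊥-elim (one-vertex-left s t p A z 2≤t |A| (≤-trans a≤ (*-monoˡ-≤ p (m≤m+n s 2)))
      (subst (λ k → (s + t + 2) * suc k < E (A ++ z ∷ []) (A ++ z ∷ [])) (+-identityʳ p) e>))
  grow s t 2≤t (suc μ) p A B |A| |B| bal a≤ e> with advance p μ A B |B| bal
  ... | y , B′ , B↭ , bal′ with E (y ∷ A) (y ∷ A) ≤? s * suc p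
  ...   | yes a′≤ =
    let (C , D , CD , c> , d>) = grow s t 2≤t μ (suc p) (y ∷ A) B′ (cong suc |A|) |B′| bal′ a′≤ e′>
    in C , D , ↭-trans moved CD , c> , d>
    where
    moved : A ++ B ↭ y ∷ A ++ B′
    moved = ↭-trans (++⁺ˡ A B↭) (shift y A B′)
    |B′| : length B′ ≡ suc μ
    |B′| = suc-injective (≡.trans (≡.sym (↭-length B↭)) |B|)
    e′> : (s + t + 2) * suc (suc p + μ) < E (y ∷ A ++ B′) (y ∷ A ++ B′)
    e′> = ≡.subst₂ (λ k x → (s + t + 2) * suc k < x) (+-suc p μ) (E-↭ moved) e>
  ...   | no a′≰ = y ∷ A , B′ , moved ,
      subst (λ k → s * k < E (y ∷ A) (y ∷ A)) (≡.sym |A|) (≰⇒> a′≰) ,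
      subst (λ k → t * (k ∸ 1) < E B′ B′) (≡.sym |B′|)
        (complement-dense s t (suc p) μ (y ∷ A) B′ 2≤t (cong suc |A|) |B′| (s≤s z≤n) a′≤ bal′ e′>)
    where
    open ≤-Reasoning
    moved : A ++ B ↭ y ∷ A ++ B′
    moved = ↭-trans (++⁺ˡ A B↭) (shift y A B′)
    |B′| : length B′ ≡ suc μ
    |B′| = suc-injective (≡.trans (≡.sym (↭-length B↭)) |B|)
    e′> : (s + t + 2) * suc (suc p + μ) < E (y ∷ A ++ B′) (y ∷ A ++ B′)
    e′> = ≡.subst₂ (λ k x → (s + t + 2) * suc k < x) (+-suc p μ) (E-↭ moved) e>
    arith : ∀ s p → s * p + 2 * suc p + s ≡ (s + 2) * suc p
    arith = solve-∀
    -- The new vertex has at most |A| = p + 1 neighbours in A; the spare s turns the bound into a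
    -- multiple of `suc p`.
    a′≤ : E (y ∷ A) (y ∷ A) ≤ (s + 2) * suc p
    a′≤ = begin
      E (y ∷ A) (y ∷ A)       ≡⟨ E-∷ y A ⟩
      E A A + 2 * deg y A     ≤⟨ +-mono-≤ a≤ (*-monoʳ-≤ 2 (≤-trans (deg≤length y A) (≤-reflexive |A|))) ⟩
      s * p + 2 * suc p       ≤⟨ m≤m+n _ s ⟩
      s * p + 2 * suc p + s   ≡⟨ arith s p ⟩
      (s + 2) * suc p         ∎

  split : ∀ s t S → 2 ≤ t → (s + t + 2) * (length S ∸ 1) < E S S → Splits s t S
  split s t (x ∷ []) 2≤t e> = ⊥-elim (n≮0 (≤-trans e> (≤-reflexive E-[ x ])))
  split s t (x ∷ y ∷ B) 2≤t e> =
    grow s t 2≤t (length B) 0 (x ∷ []) (y ∷ B) ≡.refl ≡.refl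
      -- For a one-vertex A the left side of `Balanced` has the factor p = 0, so any starting vertex
      -- will do.
      (≤-trans (≤-reflexive (*-zeroʳ (E (x ∷ y ∷ B) (x ∷ y ∷ B)))) z≤n)
      (≤-trans (≤-reflexive E-[ x ]) z≤n) e>

-- Auxiliary facts on decisions and lists.

-- For reachability by rotations: the goal there is `⊥`, so excluded middle may be applied to all
-- vertices at once under double negation.
¬¬-decide : ∀ n (P : Fin n → Set) → ¬ ¬ (∀ i → Dec (P i))
¬¬-decide zero    P k = k λ ()
¬¬-decide (suc n) P k = ¬¬-excluded-middle λ P0? → ¬¬-decide n (P ∘ suc) λ P? →
  k λ { zero → P0? ; (suc i) → P? i }

module _ {A : Set} {P : A → Set} (P? : ∀ x → Dec (P x)) where

  indicator : A → ℕ
  indicator x = if does (P? x) then 1 else 0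

  indicator-true : ∀ {x} → P x → indicator x ≡ 1
  indicator-true {x} Px with P? x
  ... | yes _  = ≡.refl
  ... | no ¬Px = ⊥-elim (¬Px Px)

  separate : ∀ xs → ∃₂ λ us vs → xs ↭ us ++ vs × All P us × length us ≡ ∑ indicator xs
  separate []       = [] , [] , refl , [] , ≡.refl
  separate (x ∷ xs) with separate xs | P? x
  ... | us , vs , xs↭ , Pus , |us| | yes Px = x ∷ us , vs , prep x xs↭ , Px ∷ Pus , cong suc |us|
  ... | us , vs , xs↭ , Pus , |us| | no _   =
    us , x ∷ vs , ↭-trans (prep x xs↭) (↭-sym (shift x us vs)) , Pus , |us|

-- A vertex left over after the initial segment certifies that this segment has all m vertices; a
-- short list would give fewer.
∈-drop⇒length-take : ∀ {A : Set} {y : A} m xs → y ∈ drop m xs → length (take m xs) ≡ m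
∈-drop⇒length-take zero    xs       y∈ = ≡.refl
∈-drop⇒length-take (suc m) (x ∷ xs) y∈ = cong suc (∈-drop⇒length-take m xs y∈)

last : {A : Set} → A → List A → A
last x []       = x
last x (y ∷ ys) = last y ys

last-∷ʳ : ∀ {A : Set} (x : A) xs y → last x (xs ++ y ∷ []) ≡ y
last-∷ʳ x []       y = ≡.refl
last-∷ʳ x (z ∷ zs) y = last-∷ʳ z zs y

Linked-prefix : ∀ {A : Set} {R : A → A → Set} xs {ys} → Linked R (xs ++ ys) → Linked R xs
Linked-prefix []           _        = []
Linked-prefix (x ∷ [])     _        = [-]
Linked-prefix (x ∷ y ∷ xs) (r ∷ rs) = r ∷ Linked-prefix (y ∷ xs) rs

-- Long cycles in dense vertex sets.

module Circumference {n : ℕ} (d : Fin n → Fin n → ℕ) (d-sym : ∀ u w → d u w ≡ d w u)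
                     (d-irrefl : ∀ u → d u u ≡ 0) (d≤1 : ∀ u w → d u w ≤ 1) where

  open Density d d-sym d-irrefl d≤1

  V : Set
  V = Fin n

  _~_ : V → V → Set
  u ~ w = 0 < d u w

  ~-sym : ∀ {u w} → u ~ w → w ~ u
  ~-sym {u} {w} = subst (0 <_) (d-sym u w)

  Path : List V → Set
  Path = Linked _~_

  -- The permutation both places the cycle in S and, for duplicate-free S, makes its vertices
  -- distinct. For ℓ at most 2 a single edge already qualifies.
  LongCycle : ℕ → List V → Set
  LongCycle ℓ S = ∃[ c ] ∃[ cs ] ∃[ T ]
    (Path (c ∷ cs) × last c cs ~ c × ℓ ≤ suc (length cs) × S ↭ c ∷ cs ++ T)

  LongCycle-⊆ : ∀ {ℓ S S′} T → S ↭ S′ ++ T → LongCycle ℓ S′ → LongCycle ℓ S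
  LongCycle-⊆ T S↭ (c , cs , T′ , path , closed , long , S′↭) =
    c , cs , T′ ++ T , path , closed , long ,
    ↭-trans S↭ (↭-trans (++⁺ʳ T S′↭) (↭-reflexive (++-assoc (c ∷ cs) T′ T)))

  deg≡0 : ∀ u L → (∀ {w} → w ∈ L → ¬ u ~ w) → deg u L ≡ 0
  deg≡0 u L no-nbr = n≤0⇒n≡0 (≤-trans (∑-mono L (λ w∈L → ≮⇒≥ (no-nbr w∈L)))
    (≤-reflexive (≡.trans (∑-const 0 L) (*-zeroʳ (length L)))))

  E≤complete : ∀ S → E S S ≤ length S * (length S ∸ 1)
  E≤complete S = ≤-trans (∑-mono S deg≤) (≤-reflexive (∑-const _ S))
    where
    deg≤ : ∀ {u} → u ∈ S → deg u S ≤ length S ∸ 1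
    deg≤ {u} u∈S with ∈⇒↭ u∈S
    ... | S′ , S↭ = begin
      deg u S           ≡⟨ deg-irrefl u S↭ ⟩
      deg u S′          ≤⟨ deg≤length u S′ ⟩
      length S′         ≡⟨ cong (_∸ 1) (↭-length S↭) ⟨
      length S ∸ 1      ∎
      where open ≤-Reasoning

  -- Rotating the path W ++ R at its first vertex u along a chord u ~ b makes
  -- the predecessor of b the new first vertex. The scan over W keeps the part
  -- acc already passed in reversed order.
  module Rotations (W R : List V) where

    Reachable : V → Set
    Reachable u = ∃[ Q ] (Path (u ∷ Q ++ R) × u ∷ Q ↭ W)

    module _ (Reachable? : ∀ u → Dec (Reachable u)) where

      χ : V → ℕ
      χ = indicator Reachable?

      -- Each neighbour b of u is charged to its own predecessor a. `reconnect` records that the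
      -- passed prefix, walked backwards from a to u, can continue at any neighbour of u.
      rotate : ∀ u a acc post →
        (∀ {b T} → u ~ b → Path (b ∷ T) → Path (a ∷ acc ++ b ∷ T)) →
        Path (a ∷ post ++ R) → a ∷ acc ++ post ↭ W → deg u post ≤ ∑ χ (a ∷ post)
      rotate u a acc []         reconnect path perm = z≤n
      rotate u a acc (b ∷ post) reconnect path perm =
        +-mono-≤ (chord (d u b) ≡.refl)
          (rotate u b (a ∷ acc) post (λ u~c p → ~-sym (head path) ∷ reconnect u~c p) (tail path)
            (↭-trans (↭-sym (shift b (a ∷ acc) post)) perm))
        where
        chord : ∀ k → d u b ≡ k → d u b ≤ χ a
        chord zero    eq = ≤-trans (≤-reflexive eq) z≤n
        chord (suc k) eq = ≤-trans (d≤1 u b) (≤-reflexive (≡.sym (indicator-true Reachable?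
          (acc ++ b ∷ post ,
           subst (Path ∘ (a ∷_)) (≡.sym (++-assoc acc (b ∷ post) R))
             (reconnect (subst (0 <_) (≡.sym eq) (s≤s z≤n)) (tail path)) ,
           perm))))

      deg≤reachable : ∀ {u Q} → Path (u ∷ Q ++ R) → u ∷ Q ↭ W → deg u W ≤ ∑ χ W
      deg≤reachable {u} {Q} path perm = begin
        deg u W        ≡⟨ deg-irrefl u (↭-sym perm) ⟩
        deg u Q        ≤⟨ rotate u u [] Q (λ u~b p → u~b ∷ p) path perm ⟩
        ∑ χ (u ∷ Q)    ≡⟨ ∑-↭ χ perm ⟩
        ∑ χ W          ∎
        where open ≤-Reasoning

  module _ (m′ : ℕ) where

    private
      m : ℕ
      m = suc m′

    Sparse : List V → Set
    Sparse S = E S S ≤ m * (length S ∸ 1)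

    Sparse-↭ : ∀ {S S′} → S ↭ S′ → Sparse S → Sparse S′
    Sparse-↭ p = ≡.subst₂ (λ e k → e ≤ m * (k ∸ 1)) (E-↭ p) (↭-length p)

    -- The weights 1 and 2 make the sum over `us` exactly the drop in `E`, so each deleted vertex
    -- costs at most m, which is what the right side loses.
    delete-sparse : ∀ us S′ → (∀ {u} → u ∈ us → deg u us + 2 * deg u S′ ≤ m) →
                    1 ≤ length S′ → Sparse S′ → Sparse (us ++ S′)
    delete-sparse us S′ deg≤ 1≤ sparse = begin
      E (us ++ S′) (us ++ S′)                         ≡⟨ E-++ us S′ ⟩
      E us us + E S′ S′ + 2 * E us S′                 ≡⟨ exchange (E us us) (E S′ S′) _ ⟩
      E us us + 2 * E us S′ + E S′ S′                 ≡⟨ cong (_+ E S′ S′) touching ⟨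
      ∑ (λ u → deg u us + 2 * deg u S′) us + E S′ S′  ≤⟨ +-mono-≤ (∑-mono us deg≤) sparse ⟩
      ∑ (λ _ → m) us + m * (length S′ ∸ 1)            ≡⟨ cong (_+ m * (length S′ ∸ 1))
                                                           (≡.trans (∑-const m us) (*-comm (length us) m)) ⟩
      m * length us + m * (length S′ ∸ 1)             ≡⟨ *-distribˡ-+ m (length us) _ ⟨
      -- Subtraction is truncated, so taking the 1 from S′ alone requires S′ to be nonempty.
      m * (length us + (length S′ ∸ 1))               ≡⟨ cong (m *_) (+-∸-assoc (length us) 1≤) ⟨
      m * (length us + length S′ ∸ 1)                 ≡⟨ cong (λ k → m * (k ∸ 1)) (length-++ us) ⟨
      m * (length (us ++ S′) ∸ 1)                     ∎
      where
      open ≤-Reasoning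
      exchange : ∀ a b c → a + b + c ≡ a + c + b
      exchange = solve-∀
      touching : ∑ (λ u → deg u us + 2 * deg u S′) us ≡ E us us + 2 * E us S′
      touching = ≡.trans (∑-+ (λ u → deg u us) (λ u → 2 * deg u S′) us)
                         (cong (E us us +_) (∑-* 2 (λ u → deg u S′) us))

    module _ (S : List V) (acyclic : ¬ LongCycle (suc m) S) (m<|S| : m < length S)
             (dense : ¬ Sparse S)
             (smaller : ∀ us S′ → S ↭ us ++ S′ → 1 ≤ length us → Sparse S′) where

      -- The chord closes the segment from u through all of Q to y, which has more than m vertices.
      no-chord-to-rest : ∀ u Q R O → Path (u ∷ Q ++ R) → S ↭ (u ∷ Q ++ R) ++ O →
        m ≤ length (u ∷ Q) → ∀ {y} → y ∈ R → ¬ u ~ y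
      no-chord-to-rest u Q R O path S↭ m≤ {y} y∈R u~y with ∈-∃++ y∈R
      ... | R₁ , R₂ , ≡.refl = acyclic (u , (Q ++ R₁) ++ y ∷ [] , R₂ ++ O ,
        Linked-prefix (u ∷ (Q ++ R₁) ++ y ∷ []) (subst Path split≡ path) ,
        subst (_~ u) (≡.sym (last-∷ʳ u (Q ++ R₁) y)) (~-sym u~y) ,
        s≤s (≤-trans m≤ long) ,
        ↭-trans S↭ (↭-reflexive (≡.trans (cong (_++ O) split≡) (++-assoc (u ∷ (Q ++ R₁) ++ y ∷ []) R₂ O))))
        where
        open ≡-Reasoning
        split≡ : u ∷ Q ++ R₁ ++ y ∷ R₂ ≡ (u ∷ (Q ++ R₁) ++ y ∷ []) ++ R₂
        split≡ = cong (u ∷_) (begin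
          Q ++ R₁ ++ y ∷ R₂                ≡⟨ ++-assoc Q R₁ (y ∷ R₂) ⟨
          (Q ++ R₁) ++ y ∷ R₂              ≡⟨ ++-assoc (Q ++ R₁) (y ∷ []) R₂ ⟨
          ((Q ++ R₁) ++ y ∷ []) ++ R₂      ∎)
        long : length (u ∷ Q) ≤ length ((Q ++ R₁) ++ y ∷ [])
        long = ≤-trans (s≤s (≤-trans (m≤m+n (length Q) (length R₁)) (≤-reflexive (≡.sym (length-++ Q)))))
          (≤-reflexive (≡.trans (+-comm 1 _) (≡.sym (length-++ (Q ++ R₁)))))

      -- Instead of choosing a longest path, recursion on a bound k for the number of vertices off
      -- the path: a reachable first vertex with a neighbour in O gives a longer path. Otherwise the
      -- neighbours of all such vertices lie in W.
      extend : ∀ k x P O → length O ≤ k → Path (x ∷ P) → S ↭ x ∷ P ++ O → ⊥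
      extend k x P O |O|≤ path S↭ = ¬¬-decide n Reachable λ Reachable? →
        let (us , vs , W↭ , reach , |us|) = separate Reachable? W in
        contra Reachable? us vs W↭ reach |us|
        where
        W R : List V
        W = take m (x ∷ P)
        R = drop m (x ∷ P)
        open Rotations W R
        W++R : W ++ R ≡ x ∷ P
        W++R = take++drop≡id m (x ∷ P)
        S↭WRO : S ↭ W ++ R ++ O
        S↭WRO = ↭-trans S↭ (↭-reflexive (≡.trans (cong (_++ O) (≡.sym W++R)) (++-assoc W R O)))
        |W|≤m : length W ≤ m
        |W|≤m = ≤-trans (≤-reflexive (length-take m (x ∷ P))) (m⊓n≤m m _)

        S↭reached : ∀ {u Q} → u ∷ Q ↭ W → S ↭ (u ∷ Q ++ R) ++ O
        S↭reached {u} {Q} perm = ↭-trans S↭WRO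
          (↭-trans (++⁺ʳ (R ++ O) (↭-sym perm)) (↭-reflexive (≡.sym (++-assoc (u ∷ Q) R O))))

        unextendable : ∀ {u} → Reachable u → ∀ {y} → y ∈ O → ¬ u ~ y
        unextendable {u} (Q , path′ , perm) {y} y∈O u~y with ∈⇒↭ y∈O
        ... | O′ , O↭ = longer k |O|≤
          where
          S↭′ : S ↭ (y ∷ u ∷ Q ++ R) ++ O′
          S↭′ = ↭-trans (S↭reached perm) (↭-trans (++⁺ˡ (u ∷ Q ++ R) O↭) (shift y (u ∷ Q ++ R) O′))
          -- Matching on k here makes the recursive call structural; zero is impossible because O
          -- contains y.
          longer : ∀ k → length O ≤ k → ⊥
          longer zero    |O|≤ = n≮0 (≤-trans (≤-reflexive (≡.sym (↭-length O↭))) |O|≤)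
          longer (suc k) |O|≤ = extend k y (u ∷ Q ++ R) O′
            (≤-pred (≤-trans (≤-reflexive (≡.sym (↭-length O↭))) |O|≤)) (~-sym u~y ∷ path′) S↭′

        chordless : ∀ {u} → Reachable u → ∀ {y} → y ∈ R → ¬ u ~ y
        chordless {u} (Q , path′ , perm) y∈R = no-chord-to-rest u Q R O path′ (S↭reached perm)
          (≤-reflexive (≡.trans (≡.sym (∈-drop⇒length-take m (x ∷ P) y∈R)) (≡.sym (↭-length perm)))) y∈R

        deg-RO : ∀ {u} → Reachable u → deg u (R ++ O) ≡ 0
        deg-RO {u} r = ≡.trans (∑-++ (d u) R O)
          (cong₂ _+_ (deg≡0 u R (chordless r)) (deg≡0 u O (unextendable r)))

        head-reachable : Reachable x
        head-reachable = take m′ P , subst (Path ∘ (x ∷_)) (≡.sym (take++drop≡id m′ P)) path , refl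

        contra : (Reachable? : ∀ u → Dec (Reachable u)) → ∀ us vs → W ↭ us ++ vs → All Reachable us →
                 length us ≡ ∑ (indicator Reachable?) W → ⊥
        contra Reachable? us vs W↭ reach |us| =
          dense (Sparse-↭ (↭-sym S↭′)
            (delete-sparse us S′ deg≤m 1≤|S′| (smaller us S′ S↭′ 1≤|us|)))
          where
          open ≤-Reasoning
          S′ : List V
          S′ = vs ++ R ++ O
          S↭′ : S ↭ us ++ S′
          S↭′ = ↭-trans S↭WRO (↭-trans (++⁺ʳ (R ++ O) W↭) (↭-reflexive (++-assoc us vs (R ++ O))))
          |W| : length us + length vs ≡ length W
          |W| = ≡.trans (≡.sym (length-++ us)) (≡.sym (↭-length W↭))
          1≤|us| : 1 ≤ length us
          1≤|us| = begin
            1                                 ≡⟨ indicator-true Reachable? head-reachable ⟨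
            indicator Reachable? x            ≤⟨ m≤m+n _ _ ⟩
            ∑ (indicator Reachable?) W        ≡⟨ |us| ⟨
            length us                         ∎
          1≤|S′| : 1 ≤ length S′
          1≤|S′| = +-cancelˡ-≤ (length us) 1 (length S′) (begin
            length us + 1                     ≡⟨ +-comm (length us) 1 ⟩
            suc (length us)                   ≤⟨ s≤s (m≤m+n (length us) (length vs)) ⟩
            suc (length us + length vs)       ≡⟨ cong suc |W| ⟩
            suc (length W)                    ≤⟨ s≤s |W|≤m ⟩
            suc m                             ≤⟨ m<|S| ⟩
            length S                          ≡⟨ ↭-length S↭′ ⟩
            length (us ++ S′)                 ≡⟨ length-++ us ⟩
            length us + length S′             ∎)
          deg≤m : ∀ {u} → u ∈ us → deg u us + 2 * deg u S′ ≤ m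
          deg≤m {u} u∈us = begin
            deg u us + 2 * deg u S′
              ≡⟨ cong (λ k → deg u us + 2 * k) (≡.trans (∑-++ (d u) vs (R ++ O))
                   (≡.trans (cong (deg u vs +_) (deg-RO r)) (+-identityʳ (deg u vs)))) ⟩
            -- One copy of `deg u vs` completes `deg u W`, which rotations bound by |us|; the other
            -- is at most |vs|.
            deg u us + 2 * deg u vs           ≡⟨ regroup (deg u us) (deg u vs) ⟩
            deg u us + deg u vs + deg u vs    ≡⟨ cong (_+ deg u vs) (∑-++ (d u) us vs) ⟨
            deg u (us ++ vs) + deg u vs       ≡⟨ cong (_+ deg u vs) (∑-↭ (d u) W↭) ⟨
            deg u W + deg u vs
              ≤⟨ +-mono-≤ (deg≤reachable Reachable? (proj₁ (proj₂ r)) (proj₂ (proj₂ r))) (deg≤length u vs) ⟩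
            ∑ (indicator Reachable?) W + length vs
              ≡⟨ cong (_+ length vs) |us| ⟨
            length us + length vs             ≡⟨ |W| ⟩
            length W                          ≤⟨ |W|≤m ⟩
            m                                 ∎
            where
            r : Reachable u
            r = All.lookup reach u∈us
            regroup : ∀ a b → a + 2 * b ≡ a + b + b
            regroup = solve-∀

    -- Strong induction on |S| through the bound k. Up to m vertices even a complete graph is
    -- sparse; beyond that, `extend` starts from a one-vertex path.
    erdős-gallai-bounded : ∀ k S → length S ≤ k → ¬ LongCycle (suc m) S → Sparse S
    erdős-gallai-bounded k       []      _    acyclic = z≤n
    erdős-gallai-bounded (suc k) (x ∷ O) |S|≤ acyclic with suc (length O) ≤? m
    ... | yes |S|≤m = ≤-trans (E≤complete (x ∷ O)) (*-monoˡ-≤ (length O) |S|≤m)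
    ... | no  |S|≰m = decidable-stable (_ ≤? _) λ dense →
      extend (x ∷ O) acyclic (≰⇒> |S|≰m) dense smaller (length O) x [] O ≤-refl [-] refl
      where
      smaller : ∀ us S′ → x ∷ O ↭ us ++ S′ → 1 ≤ length us → Sparse S′
      smaller us S′ S↭ 1≤|us| = erdős-gallai-bounded k S′ (≤-pred (begin
          suc (length S′)           ≤⟨ +-monoˡ-≤ (length S′) 1≤|us| ⟩
          length us + length S′     ≡⟨ length-++ us ⟨
          length (us ++ S′)         ≡⟨ ↭-length S↭ ⟨
          suc (length O)            ≤⟨ |S|≤ ⟩
          suc k                     ∎))
        (acyclic ∘ LongCycle-⊆ us (↭-trans S↭ (++-comm us S′)))
        where open ≤-Reasoning

    erdős-gallai : ∀ S → m * (length S ∸ 1) < E S S → ¬ ¬ LongCycle (suc m) S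
    erdős-gallai S dense acyclic = <⇒≱ dense (erdős-gallai-bounded (length S) S ≤-refl acyclic)

-- Counting the vertices of a disjoint union of cycles.

sumFin≡∑ : ∀ {A : Set} m (f : A → ℕ) (g : Fin m → A) → sumFin m (f ∘ g) ≡ ∑ f (tabulate g)
sumFin≡∑ zero    f g = ≡.refl
sumFin≡∑ (suc m) f g = cong (f (g zero) +_) (sumFin≡∑ m f (g ∘ suc))

unflatten : ∀ k (ℓ : Fin k → ℕ) → Fin (sumFin k ℓ) → Σ (Fin k) (Fin ∘ ℓ)
unflatten (suc k) ℓ i with splitAt (ℓ zero) i
... | inj₁ a = zero , a
... | inj₂ j = let (i′ , a) = unflatten k (ℓ ∘ suc) j in suc i′ , a

flatten : ∀ k (ℓ : Fin k → ℕ) → Σ (Fin k) (Fin ∘ ℓ) → Fin (sumFin k ℓ)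
flatten (suc k) ℓ (zero  , a) = a ↑ˡ _
flatten (suc k) ℓ (suc i , a) = ℓ zero ↑ʳ flatten k (ℓ ∘ suc) (i , a)

flatten-unflatten : ∀ k ℓ i → flatten k ℓ (unflatten k ℓ i) ≡ i
flatten-unflatten (suc k) ℓ i with splitAt (ℓ zero) i in eq
... | inj₁ a = splitAt⁻¹-↑ˡ eq
... | inj₂ j = ≡.trans (cong (ℓ zero ↑ʳ_) (flatten-unflatten k (ℓ ∘ suc) j)) (splitAt⁻¹-↑ʳ eq)

-- The map `from ∘ unflatten k ℓ` is injective, since `to` and then `flatten` undo it.
sumFin≤ : ∀ {h} k (ℓ : Fin k → ℕ) → Fin h ↔ Σ (Fin k) (Fin ∘ ℓ) → sumFin k ℓ ≤ h
sumFin≤ k ℓ iso = injective⇒≤ {f = from ∘ unflatten k ℓ} λ {i} {j} eq →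
  ≡.trans (≡.sym (flatten-unflatten k ℓ i)) (≡.trans
    (cong (flatten k ℓ) (≡.trans (≡.sym (strictlyInverseˡ _))
      (≡.trans (cong to eq) (strictlyInverseˡ _))))
    (flatten-unflatten k ℓ j))
  where open Inverse iso

-- Branch sets as association lists.

keys : ∀ {A X : Set} → List (A × X) → List A
keys = map proj₁

keys-constant : ∀ {A X : Set} (x : X) (us : List A) → keys (map (_, x) us) ≡ us
keys-constant x []       = ≡.refl
keys-constant x (u ∷ us) = cong (u ∷_) (keys-constant x us)

relabel : ∀ {A X Y : Set} → (X → Y) → List (A × X) → List (A × Y)
relabel f = map λ (u , x) → u , f x

keys-relabel : ∀ {A X Y : Set} (f : X → Y) (al : List (A × X)) → keys (relabel f al) ≡ keys al
keys-relabel f al = ≡.sym (map-∘ al)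

∈-relabel⁺ : ∀ {A X Y : Set} (f : X → Y) {al : List (A × X)} {u x} →
             (u , x) ∈ al → (u , f x) ∈ relabel f al
∈-relabel⁺ f = ∈-map⁺ λ (u , x) → u , f x

∈-relabel⁻ : ∀ {A X Y : Set} (f : X → Y) (al : List (A × X)) {u y} →
             (u , y) ∈ relabel f al → ∃[ x ] ((u , x) ∈ al × y ≡ f x)
∈-relabel⁻ f al u∈ with ∈-map⁻ (λ (u , x) → u , f x) u∈
... | (u , x) , u∈al , ≡.refl = x , u∈al , ≡.refl

module _ {n : ℕ} {X : Set} where

  find : List (Fin n × X) → Fin n → Maybe X
  find []             u = nothing
  find ((w , x) ∷ al) u with u ≟ w
  ... | yes _ = just x
  ... | no  _ = find al u

  find-sound : ∀ al {u x} → find al u ≡ just x → (u , x) ∈ al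
  find-sound ((w , x) ∷ al) {u} eq with u ≟ w
  ... | yes ≡.refl = here (cong (u ,_) (≡.sym (just-injective eq)))
  ... | no  _      = there (find-sound al eq)

  -- Unique keys exclude an earlier entry for u with another label. T stands for the vertices
  -- outside all branch sets.
  find-complete : ∀ al {T u x} → Unique (keys al ++ T) → (u , x) ∈ al → find al u ≡ just x
  find-complete ((w , y) ∷ al) {u = u} (w∉ ∷ uniq) u∈ with u ≟ w | u∈
  ... | yes _      | here ≡.refl = ≡.refl
  ... | yes ≡.refl | there u∈al  = ⊥-elim (All.lookup w∉ (∈-++⁺ˡ (∈-map⁺ proj₁ u∈al)) ≡.refl)
  ... | no  u≢w    | here ≡.refl = ⊥-elim (u≢w ≡.refl)
  ... | no  _      | there u∈al  = find-complete al uniq u∈al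

-- Edges of a graph as weights.

module _ (G : Graph) where

  weight : Fin (n G) → Fin (n G) → ℕ
  weight u w = b2n (adj G u w)

  b2n≤1 : ∀ b → b2n b ≤ 1
  b2n≤1 true  = s≤s z≤n
  b2n≤1 false = z≤n

  b2n-true : ∀ {b} → 0 < b2n b → b ≡ true
  b2n-true {true} _ = ≡.refl

  open Density weight (λ u w → cong b2n (sym G u w)) (cong b2n ∘ irrefl G)
    (λ u w → b2n≤1 (adj G u w))
  open Circumference weight (λ u w → cong b2n (sym G u w)) (cong b2n ∘ irrefl G)
    (λ u w → b2n≤1 (adj G u w))

  vertices : List V
  vertices = allFin (n G)

  -- `e` counts an edge only at the ordered pair with i < j; adding the transposed sum counts it at
  -- both pairs.
  2e≡E : 2 * e G ≡ E vertices vertices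
  2e≡E = begin
    2 * e G                             ≡⟨ cong (2 *_) e≡ ⟩
    H + (H + 0)                         ≡⟨ cong (H +_) (+-identityʳ H) ⟩
    H + H                               ≡⟨ cong (H +_) (∑-swap half vertices vertices) ⟩
    H + ∑ (λ i → ∑ (λ j → half j i) vertices) vertices
      ≡⟨ ∑-+ (λ i → ∑ (half i) vertices) (λ i → ∑ (λ j → half j i) vertices) vertices ⟨
    ∑ (λ i → ∑ (half i) vertices + ∑ (λ j → half j i) vertices) vertices
      ≡⟨ ∑-cong (λ i → ∑-+ (half i) (λ j → half j i) vertices) vertices ⟨
    ∑ (λ i → ∑ (λ j → half i j + half j i) vertices) vertices
      ≡⟨ ∑-cong (λ i → ∑-cong (halves i) vertices) vertices ⟩
    E vertices vertices                 ∎
    where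
    open ≡-Reasoning
    half : V → V → ℕ
    half i j = b2n (⌊ toℕ i <? toℕ j ⌋ ∧ adj G i j)
    H = ∑ (λ i → ∑ (half i) vertices) vertices
    e≡ : e G ≡ H
    e≡ = ≡.trans (sumFin≡∑ (n G) (λ i → sumFin (n G) (half i)) id)
                 (∑-cong (λ i → sumFin≡∑ (n G) (half i) id) vertices)
    halves : ∀ i j → half i j + half j i ≡ weight i j
    halves i j with toℕ i <? toℕ j | toℕ j <? toℕ i
    ... | yes i<j | yes j<i = ⊥-elim (<-asym i<j j<i)
    ... | yes _   | no  _   = +-identityʳ _
    ... | no  _   | yes _   = cong b2n (sym G j i)
    ... | no  i≮j | no  j≮i with toℕ-injective (≤-antisym (≮⇒≥ j≮i) (≮⇒≥ i≮j))
    ...   | ≡.refl = ≡.sym (cong b2n (irrefl G i))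

  -- Packing disjoint long cycles.

  Packing : ∀ k → (Fin k → ℕ) → List V → Set
  Packing zero    ℓ S = ⊤
  Packing (suc k) ℓ S =
    ∃₂ λ A B → S ↭ A ++ B × LongCycle (ℓ zero) A × Packing k (ℓ ∘ suc) B

  long-cycle : ∀ ℓ S → 3 ≤ ℓ → (ℓ ∸ 1) * (length S ∸ 1) < E S S → ¬ ¬ LongCycle ℓ S
  long-cycle (suc (suc ℓ)) S (s≤s (s≤s _)) = erdős-gallai ℓ S

  -- The threshold is the sum of all `ℓ i + 1`, less 2. With s = `ℓ zero ∸ 1` and t the threshold of
  -- the remaining cycles it equals s + t + 2, as `split` demands.
  packing : ∀ k (ℓ : Fin (suc k) → ℕ) → (∀ i → 3 ≤ ℓ i) → ∀ S →
            (sumFin (suc k) ℓ + suc k ∸ 2) * (length S ∸ 1) < E S S → ¬ ¬ Packing (suc k) ℓ S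
  packing zero ℓ 3≤ℓ S dense none = long-cycle (ℓ zero) S (3≤ℓ zero)
    (subst (λ c → c * (length S ∸ 1) < E S S) (cong (_∸ 2) (arith (ℓ zero))) dense)
    λ cycle → none (S , [] , ↭-reflexive (≡.sym (++-identityʳ S)) , cycle , tt)
    where
    arith : ∀ x → x + 0 + 1 ≡ 1 + x
    arith = solve-∀
  packing (suc k) ℓ 3≤ℓ S dense none =
    let (A , B , S↭ , denseA , denseB) = split (ℓ zero ∸ 1) t S 2≤t
          (subst (λ c → c * (length S ∸ 1) < E S S) total≡ dense)
    in long-cycle (ℓ zero) A (3≤ℓ zero) denseA λ cycle →
       packing k (ℓ ∘ suc) (3≤ℓ ∘ suc) B denseB λ rest →
       none (A , B , S↭ , cycle , rest)
    where
    open ≡-Reasoning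
    σ = sumFin (suc k) (ℓ ∘ suc)
    t = σ + suc k ∸ 2
    -- At least one further cycle remains, contributing at least 3 vertices and one component.
    4≤ : 4 ≤ σ + suc k
    4≤ = +-mono-≤ (≤-trans (3≤ℓ (suc zero)) (m≤m+n _ _)) (s≤s z≤n)
    2≤t : 2 ≤ t
    2≤t = ∸-monoˡ-≤ 2 4≤
    arith : ∀ x s k → suc x + s + suc (suc k) ≡ 2 + (x + (s + suc k))
    arith = solve-∀
    total≡ : sumFin (suc (suc k)) ℓ + suc (suc k) ∸ 2 ≡ ℓ zero ∸ 1 + t + 2
    total≡ = begin
      ℓ zero + σ + suc (suc k) ∸ 2                  ≡⟨ cong (λ x → x + σ + suc (suc k) ∸ 2)
                                                         (m+[n∸m]≡n (≤-trans (s≤s z≤n) (3≤ℓ zero))) ⟨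
      suc (ℓ zero ∸ 1) + σ + suc (suc k) ∸ 2        ≡⟨ cong (_∸ 2) (arith (ℓ zero ∸ 1) σ k) ⟩
      ℓ zero ∸ 1 + (σ + suc k)                      ≡⟨ cong (ℓ zero ∸ 1 +_)
                                                         (m∸n+n≡m (≤-trans (s≤s (s≤s z≤n)) 4≤)) ⟨
      ℓ zero ∸ 1 + (t + 2)                          ≡⟨ +-assoc (ℓ zero ∸ 1) t 2 ⟨
      ℓ zero ∸ 1 + t + 2                            ∎

  -- Minor models from packed cycles.

  walk-map : ∀ {P Q : V → Set} → (∀ {z} → P z → Q z) → ∀ {u w} → Walk G P u w → Walk G Q u w
  walk-map f (here p)       = here (f p)
  walk-map f (step p a wlk) = step (f p) a (walk-map f wlk)

  walk-snoc : ∀ {P : V → Set} {u w t} → Walk G P u w → adj G w t ≡ true → P t → Walk G P u t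
  walk-snoc (here p)       a q = step p a (here q)
  walk-snoc (step p b wlk) a q = step p b (walk-snoc wlk a q)

  walk-reverse : ∀ {P : V → Set} {u w} → Walk G P u w → Walk G P w u
  walk-reverse (here p)               = here p
  walk-reverse (step {u} {w} p a wlk) =
    walk-snoc (walk-reverse wlk) (≡.trans (sym G w u) a) p

  walk-trans : ∀ {P : V → Set} {u w t} → Walk G P u w → Walk G P w t → Walk G P u t
  walk-trans (here _)       wlk′ = wlk′
  walk-trans (step p a wlk) wlk′ = step p a (walk-trans wlk wlk′)

  path-walk : ∀ c cs → Path (c ∷ cs) → ∀ {u} → u ∈ c ∷ cs → Walk G (_∈ c ∷ cs) c u
  path-walk c cs       path       (here ≡.refl) = here (here ≡.refl)
  path-walk c (b ∷ cs) (a ∷ path) (there u∈)    =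
    step (here ≡.refl) (b2n-true a) (walk-map there (path-walk b cs path u∈))

  -- An association list al from vertices of G to X encodes the branch sets
  -- { u ∣ (u , x) ∈ al }.
  record Model (X : Set) (N : X → X → Set) (al : List (V × X)) : Set where
    field
      nonempty  : ∀ x → ∃[ u ] ((u , x) ∈ al)
      connected : ∀ x {u w} → (u , x) ∈ al → (w , x) ∈ al → Walk G (λ z → (z , x) ∈ al) u w
      edges     : ∀ x y → N x y → ∃₂ λ u w → (u , x) ∈ al × (w , y) ∈ al × adj G u w ≡ true

  -- The first m vertices of the path become singleton branch sets and all
  -- remaining ones form the last branch set.
  path-model : ∀ m c cs → m ≤ length cs → Path (c ∷ cs) → ∃[ al ]
    (keys al ≡ c ∷ cs × Model (Fin (suc m)) (λ a b → suc (toℕ a) ≡ toℕ b) al ×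
     (c , zero) ∈ al × (last c cs , fromℕ m) ∈ al)
  path-model zero c cs _ path = al , keys≡ , record
    { nonempty  = λ { zero → c , here ≡.refl }
    -- Any two vertices are joined through the first vertex c of the path.
    ; connected = λ { zero u∈ w∈ → walk-map (∈-map⁺ (_, zero))
        (walk-trans (walk-reverse (path-walk c cs path (∈-al u∈))) (path-walk c cs path (∈-al w∈))) }
    ; edges     = λ { zero zero () }
    } , here ≡.refl , ∈-map⁺ (_, zero) (last-∈ c cs)
    where
    al : List (V × Fin 1)
    al = map (_, zero) (c ∷ cs)
    keys≡ : keys al ≡ c ∷ cs
    keys≡ = keys-constant zero (c ∷ cs)
    ∈-al : ∀ {u} → (u , zero) ∈ al → u ∈ c ∷ cs
    ∈-al {u} u∈ = subst (u ∈_) keys≡ (∈-map⁺ proj₁ u∈)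
    last-∈ : ∀ c cs → last c cs ∈ c ∷ cs
    last-∈ c []       = here ≡.refl
    last-∈ c (b ∷ cs) = there (last-∈ b cs)
  path-model (suc m) c (b ∷ cs) (s≤s m≤) (c~b ∷ path) with path-model m b cs m≤ path
  ... | al , keys≡ , model , b∈ , last∈ =
    (c , zero) ∷ al↑ , cong (c ∷_) (≡.trans (keys-relabel suc al) keys≡) , record
    { nonempty  = λ { zero → c , here ≡.refl ; (suc x) → map₂ lift (nonempty x) }
    ; connected = λ { zero    u∈ w∈ → ≡.subst₂ (Walk G _) (≡.sym (only u∈)) (≡.sym (only w∈))
                                             (here (here ≡.refl))
                    ; (suc x) u∈ w∈ → walk-map lift (connected x (lower u∈) (lower w∈)) }
    ; edges     = λ { zero (suc zero) _ → c , b , here ≡.refl , lift b∈ , b2n-true c~b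
                    ; (suc x) (suc y) eq → let (u , w , u∈ , w∈ , a) = edges x y (suc-injective eq)
                                           in u , w , lift u∈ , lift w∈ , a }
    } , here ≡.refl , lift last∈
    where
    open Model model
    al↑ : List (V × Fin (suc (suc m)))
    al↑ = relabel suc al
    lift : ∀ {u x} → (u , x) ∈ al → (u , suc x) ∈ (c , zero) ∷ al↑
    lift = there ∘ ∈-relabel⁺ suc
    lower : ∀ {u x} → (u , suc x) ∈ (c , zero) ∷ al↑ → (u , x) ∈ al
    lower (there u∈) with ∈-relabel⁻ suc al u∈
    ... | _ , u∈al , ≡.refl = u∈al
    only : ∀ {u} → (u , zero) ∈ (c , zero) ∷ al↑ → u ≡ c
    only (here ≡.refl) = ≡.refl
    only (there u∈) with ∈-relabel⁻ suc al u∈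
    ... | _ , _ , ()

  -- The last branch set absorbs the excess length and contains the end of the path, so the closing
  -- edge joins it to branch set zero.
  cycle-model : ∀ {ℓ S} → 1 ≤ ℓ → LongCycle ℓ S → ∃[ al ]
    (Model (Fin ℓ) (λ a b → suc (toℕ a) ≡ toℕ b ⊎ suc (toℕ a) ≡ ℓ × toℕ b ≡ 0) al ×
     ∃[ T ] (S ↭ keys al ++ T))
  cycle-model {suc m} _ (c , cs , T , path , closed , s≤s long , S↭) with path-model m c cs long path
  ... | al , keys≡ , model , first∈ , last∈ = al , record
    { nonempty  = nonempty
    ; connected = connected
    ; edges     = λ
      { x y (inj₁ next) → edges x y next
      ; x y (inj₂ (x-last , y-first)) → last c cs , c ,
          subst (λ z → (last c cs , z) ∈ al)
            (toℕ-injective (≡.trans (toℕ-fromℕ m) (≡.sym (suc-injective x-last)))) last∈ ,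
          subst (λ z → (c , z) ∈ al) (toℕ-injective (≡.sym y-first)) first∈ ,
          b2n-true closed }
    } , T , subst (λ C → _ ↭ C ++ T) (≡.sym keys≡) S↭
    where open Model model

  packing-model : ∀ k (ℓ : Fin k → ℕ) → (∀ i → 1 ≤ ℓ i) → ∀ {S} → Packing k ℓ S → ∃[ al ]
    (Model (Σ (Fin k) (Fin ∘ ℓ)) (CycNext ℓ) al × ∃[ T ] (S ↭ keys al ++ T))
  packing-model zero ℓ 1≤ℓ {S} _ = [] , record
    { nonempty = λ { (() , _) } ; connected = λ { (() , _) } ; edges = λ { (() , _) } } , S , refl
  packing-model (suc k) ℓ 1≤ℓ {S} (A , B , S↭ , cycle , rest)
    with cycle-model (1≤ℓ zero) cycle | packing-model k (ℓ ∘ suc) (1≤ℓ ∘ suc) rest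
  ... | al₀ , M₀ , T₀ , A↭ | al₁ , M₁ , T₁ , B↭ = al , record
    { nonempty  = λ { (zero , a) → map₂ lift₀ (M₀.nonempty a)
                    ; (suc i , a) → map₂ lift₁ (M₁.nonempty (i , a)) }
    ; connected = λ { (zero , a) u∈ w∈ → walk-map lift₀ (M₀.connected a (lower₀ u∈) (lower₀ w∈))
                    ; (suc i , a) u∈ w∈ → walk-map lift₁ (M₁.connected (i , a) (lower₁ u∈) (lower₁ w∈)) }
    ; edges     = λ { (zero , a) (zero , b) (≡.refl , next) →
                        let (u , w , u∈ , w∈ , adj-uw) = M₀.edges a b next
                        in u , w , lift₀ u∈ , lift₀ w∈ , adj-uw
                    ; (suc i , a) (suc i , b) (≡.refl , next) →
                        let (u , w , u∈ , w∈ , adj-uw) = M₁.edges (i , a) (i , b) (≡.refl , next)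
                        in u , w , lift₁ u∈ , lift₁ w∈ , adj-uw }
    } , T₀ ++ T₁ , S↭keys
    where
    module M₀ = Model M₀
    module M₁ = Model M₁
    X = Σ (Fin (suc k)) (Fin ∘ ℓ)
    in₀ : Fin (ℓ zero) → X
    in₀ a = zero , a
    in₁ : Σ (Fin k) (Fin ∘ ℓ ∘ suc) → X
    in₁ (i , a) = suc i , a
    al : List (V × X)
    al = relabel in₀ al₀ ++ relabel in₁ al₁
    lift₀ : ∀ {u a} → (u , a) ∈ al₀ → (u , in₀ a) ∈ al
    lift₀ = ∈-++⁺ˡ ∘ ∈-relabel⁺ in₀
    lift₁ : ∀ {u a} → (u , a) ∈ al₁ → (u , in₁ a) ∈ al
    lift₁ = ∈-++⁺ʳ (relabel in₀ al₀) ∘ ∈-relabel⁺ in₁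
    lower₀ : ∀ {u a} → (u , in₀ a) ∈ al → (u , a) ∈ al₀
    lower₀ u∈ with ∈-++⁻ (relabel in₀ al₀) u∈
    ... | inj₁ u∈₀ with ∈-relabel⁻ in₀ al₀ u∈₀
    ...   | _ , u∈al , ≡.refl = u∈al
    lower₀ u∈ | inj₂ u∈₁ with ∈-relabel⁻ in₁ al₁ u∈₁
    ...   | _ , _ , ()
    lower₁ : ∀ {u a} → (u , in₁ a) ∈ al → (u , a) ∈ al₁
    lower₁ u∈ with ∈-++⁻ (relabel in₀ al₀) u∈
    ... | inj₁ u∈₀ with ∈-relabel⁻ in₀ al₀ u∈₀
    ...   | _ , _ , ()
    lower₁ u∈ | inj₂ u∈₁ with ∈-relabel⁻ in₁ al₁ u∈₁
    ...   | _ , u∈al , ≡.refl = u∈al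
    keys-al : keys al ≡ keys al₀ ++ keys al₁
    keys-al = ≡.trans (map-++ proj₁ (relabel in₀ al₀) (relabel in₁ al₁))
      (cong₂ _++_ (keys-relabel in₀ al₀) (keys-relabel in₁ al₁))
    S↭keys : S ↭ keys al ++ T₀ ++ T₁
    S↭keys = ↭-trans S↭ (↭-trans (++⁺ A↭ B↭) (↭-trans
      (↭-reflexive (++-assoc (keys al₀) T₀ (keys al₁ ++ T₁))) (↭-trans
      (++⁺ˡ (keys al₀) (shifts T₀ (keys al₁))) (↭-reflexive (≡.trans
      (≡.sym (++-assoc (keys al₀) (keys al₁) (T₀ ++ T₁)))
      (cong (_++ T₀ ++ T₁) (≡.sym keys-al)))))))

  minor : ∀ (H : Graph) k (ℓ : Fin k → ℕ) (iso : Fin (v H) ↔ Σ (Fin k) (Fin ∘ ℓ)) →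
    (∀ x y → adj H x y ≡ true → CycAdj ℓ (Inverse.to iso x) (Inverse.to iso y)) →
    (∀ i → 1 ≤ ℓ i) → Packing k ℓ vertices → IsMinor H G
  minor H k ℓ iso H⊆cycles 1≤ℓ pack with packing-model k ℓ 1≤ℓ pack
  ... | al , model , T , S↭ = record
    { φ         = φ
    ; nonempty  = λ x → map₂ φ-complete (M.nonempty (to x))
    ; connected = λ x u w φu φw → walk-map φ-complete (M.connected (to x) (φ-sound φu) (φ-sound φw))
    ; edges     = λ x y xy → realise x y (H⊆cycles x y xy)
    }
    where
    module M = Model model
    open Inverse iso using (to; from; strictlyInverseˡ; strictlyInverseʳ)
    φ : V → Maybe (Fin (v H))
    φ u = Maybe.map from (find al u)
    -- The list is a rearrangement of all vertices of G, each listed once.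
    unique : Unique (keys al ++ T)
    unique = Permutationₛ.Unique-resp-↭ (≡.setoid V) (↭⇒↭ₛ S↭) (allFin⁺ (n G))
    φ-complete : ∀ {u x} → (u , to x) ∈ al → φ u ≡ just x
    φ-complete {x = x} u∈ = ≡.trans (cong (Maybe.map from) (find-complete al unique u∈))
                                    (cong just (strictlyInverseʳ x))
    φ-sound : ∀ {u x} → φ u ≡ just x → (u , to x) ∈ al
    φ-sound {u} φu with find al u in eq
    φ-sound {u} ≡.refl | just z = find-sound al (≡.trans eq (cong just (≡.sym (strictlyInverseˡ z))))
    realise : ∀ x y → CycAdj ℓ (to x) (to y) →
              ∃[ u ] ∃[ w ] (φ u ≡ just x × φ w ≡ just y × adj G u w ≡ true)
    realise x y (inj₁ next) with M.edges (to x) (to y) next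
    ... | u , w , u∈ , w∈ , a = u , w , φ-complete u∈ , φ-complete w∈ , a
    -- The model realises cycle edges in the forward direction; symmetry of `adj` gives the other.
    realise x y (inj₂ next) with M.edges (to y) (to x) next
    ... | u , w , u∈ , w∈ , a = w , u , φ-complete w∈ , φ-complete u∈ , ≡.trans (sym G w u) a

-- The bound for disjoint unions of cycles.

theorem1p3 : (H : Graph) (k : ℕ) (ℓ : Fin k → ℕ) →
    (∀ i → 3 ≤ ℓ i) →
    (iso : Fin (v H) ↔ Σ (Fin k) (λ i → Fin (ℓ i))) →
    (∀ x y → adj H x y ≡ true → CycAdj ℓ (Inverse.to iso x) (Inverse.to iso y)) →
    (∀ x y → CycAdj ℓ (Inverse.to iso x) (Inverse.to iso y) → adj H x y ≡ true) →
    2 ≤ v H →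
    (G : Graph) → 1 ≤ v G → ¬ IsMinor H G →
    2 * e G ≤ (v H + k ∸ 2) * v G
-- Without cycles, a vertex of H would have its component index in `Fin 0`.
theorem1p3 H zero ℓ 3≤ℓ iso _ _ 2≤vH G _ _
  with () ← proj₁ (Inverse.to iso (fromℕ< (≤-trans (s≤s z≤n) 2≤vH)))
-- The conclusion is decidable, so a packing under double negation is enough.
theorem1p3 H (suc k) ℓ 3≤ℓ iso H⊆cycles _ _ G _ no-minor = decidable-stable (_ ≤? _) λ dense →
  packing G k ℓ 3≤ℓ (vertices G) (begin-strict
    (sumFin (suc k) ℓ + suc k ∸ 2) * (length (vertices G) ∸ 1)
      ≤⟨ *-mono-≤ (∸-monoˡ-≤ 2 (+-monoˡ-≤ (suc k) (sumFin≤ (suc k) ℓ iso)))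
           (≤-trans (m∸n≤m _ 1) (≤-reflexive (length-tabulate id))) ⟩
    (v H + suc k ∸ 2) * v G       <⟨ ≰⇒> dense ⟩
    2 * e G                       ≡⟨ 2e≡E G ⟩
    Density.E (weight G) (λ u w → cong b2n (sym G u w)) (cong b2n ∘ irrefl G)
      (λ u w → b2n≤1 G (adj G u w)) (vertices G) (vertices G) ∎)
  (no-minor ∘ minor G H (suc k) ℓ iso H⊆cycles (λ i → ≤-trans (s≤s z≤n) (3≤ℓ i)))
  where open ≤-Reasoning
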